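{- Let $S$ be a finite set and let $p\notin S$. Let $\mathrm{Pointedmat}(S,p)$ be the set of pointed matroids $(M,p)$ on $S\cup\{p\}$ such that $p$ is not a loop of $M$. There are one-to-one correspondences between $\mathrm{Semimat}(S)$, $\mathrm{MatId}(S)$, $\mathrm{MatPreim}(S)$, $\mathrm{MatCoext}(S,p)$ and $\mathrm{Pointedmat}(S,p)$, where: - $\mathrm{Semimat}(S)$ is the set of semimatroids on $S$; - $\mathrm{MatId}(S)$ is the set of pairs $(M,\mathcal{I})$ of a matroid $M$ on $S$ and a modular ideal $\mathcal{I}$ of $M$; - $\mathrm{MatPreim}(S)$ is the set of pairs $(M,N)$ of a matroid $M$ on $S$ and one of its elementary preimages $N$; - $\mathrm{MatCoext}(S,p)$ is the set of pairs $(M,\widetilde{N})$, where $M$ is a matroid on $S$ and $\widetilde{N}$ is one of its rank-increasing single-element coextensions by $p$.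
   Context: $\mathbb{N}$ includes $0$. A simplicial complex on a finite set $S$ is a family of subsets of $S$ closed under taking subsets; singletons need not belong to it. A semimatroid (on $S$) is a triple $(S,\mathcal{C},r_{\mathcal{C}})$ consisting of a finite set $S$, a non-empty simplicial complex $\mathcal{C}$ on $S$, and a function $r_{\mathcal{C}}:\mathcal{C}\to\mathbb{N}$ such that: (R1) if $X\in\mathcal{C}$ then $0\le r_{\mathcal{C}}(X)\le |X|$; (R2) if $X,Y\in\mathcal{C}$ and $X\subseteq Y$ then $r_{\mathcal{C}}(X)\le r_{\mathcal{C}}(Y)$; (R3) if $X,Y\in\mathcal{C}$ and $X\cup Y\in\mathcal{C}$ then $r_{\mathcal{C}}(X)+r_{\mathcal{C}}(Y)\ge r_{\mathcal{C}}(X\cup Y)+r_{\mathcal{C}}(X\cap Y)$; (CR1) if $X,Y\in\mathcal{C}$ and $r_{\mathcal{C}}(X)=r_{\mathcal{C}}(X\cap Y)$ then $X\cup Y\in\mathcal{C}$; (CR2) if $X,Y\in\mathcal{C}$ and $r_{\mathcal{C}}(X)<r_{\mathcal{C}}(Y)$ then $X\cup\{y\}\in\mathcal{C}$ for some $y\in Y-X$. Matroids have finite ground sets; $r_M$ is the rank function of a matroid $M$ and $r(M)$ its rank. A modular ideal $\mathcal{I}$ of a matroid $M$ on $S$ is a non-empty collection of subsets of $S$ such that: (MI1) $\mathcal{I}$ is a simplicial complex; (MI2) $\{a\}\in\mathcal{I}$ for every non-loop $a$ of $M$; (MI3) if $X,Y\in\mathcal{I}$ and $\{X,Y\}$ is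 a modular pair in $M$, i.e. $r_M(X)+r_M(Y)=r_M(X\cup Y)+r_M(X\cap Y)$, then $X\cup Y\in\mathcal{I}$. A quotient map $N\to M$ is a pair of matroids $M,N$ on the same ground set such that every flat of $M$ is a flat of $N$; it is elementary if $r(N)-r(M)$ is $0$ or $1$. An elementary preimage of $M$ is a matroid $N$ on the same ground set such that $N\to M$ is an elementary quotient map. For a matroid $M$ on $S$ and $p\notin S$, a single-element coextension of $M$ by $p$ is a matroid $\widetilde{N}$ on $S\cup\{p\}$ with $M=\widetilde{N}/p$ (contraction of $p$); it is rank-increasing if $r(\widetilde{N})>r(M)$. A pointed matroid is a pair $(M,p)$ of a matroid $M$ and a distinguished element $p$ of its ground set. -}

module Defs where

open import Level using (0ℓ)
open import Data.Bool.Base using (Bool; T)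
open import Data.Fin.Base using (Fin; zero)
open import Data.Fin.Subset
  using (Subset; inside; outside; ⊥; ⊤; ⁅_⁆; _∈_; _⊆_; _∪_; _∩_; _─_; ∣_∣)
open import Data.Fin.Subset.Properties
  using (p∩q⊆p; s⊆s; ∪-identityʳ; ⊥⊆)
open import Data.Nat.Base using (ℕ; suc; _+_; _∸_; _≤_; _<_; _>_)
open import Data.Nat.Properties
open import Data.Product.Base using (Σ; ∃; _×_; _,_; proj₁; proj₂)
open import Data.Product.Relation.Binary.Pointwise.NonDependent using (_×ₛ_)
open import Data.Sum.Base using (_⊎_)
open import Data.Vec.Base using (_∷_)
open import Relation.Binary.Bundles using (Setoid)
import Relation.Binary.Construct.On as On
open import Relation.Binary.PropositionalEquality
  using (_≡_; refl; sym; trans; cong; cong₂; subst; _→-setoid_; setoid)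
open import Relation.Nullary.Negation.Core using (¬_)

-- The finite set S is Fin n.  The set S ∪ {p}, with p ∉ S, is Fin (suc n): the
-- new element p is zero, and s ∈ S is identified with suc s.

pt : ∀ {n} → Fin (suc n)
pt = zero

-- For X ⊆ S, the subset X ∪ {p} of S ∪ {p}.
_∪pt : ∀ {n} → Subset n → Subset (suc n)
X ∪pt = inside ∷ X

-- Subsets are boolean vectors, so families of subsets are boolean-valued too.
Family : ℕ → Set
Family n = Subset n → Bool

_∈ᶠ_ : ∀ {n} → Subset n → Family n → Set
X ∈ᶠ 𝓕 = T (𝓕 X)

infix 4 _∈ᶠ_

IsSimplicialComplex : ∀ {n} → Family n → Set
IsSimplicialComplex 𝓒 = ∀ {X Y} → X ⊆ Y → Y ∈ᶠ 𝓒 → X ∈ᶠ 𝓒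

NonEmpty : ∀ {n} → Family n → Set
NonEmpty 𝓒 = ∃ λ X → X ∈ᶠ 𝓒

-- The rank is a function on the members of 𝓒; the membership proof is
-- irrelevant, so the rank depends on the set alone.
record Semimatroid (n : ℕ) : Set where
  field
    𝓒        : Family n
    complex  : IsSimplicialComplex 𝓒
    nonEmpty : NonEmpty 𝓒
    rank     : (X : Subset n) → .(X ∈ᶠ 𝓒) → ℕ
    R1  : ∀ {X} (x : X ∈ᶠ 𝓒) → rank X x ≤ ∣ X ∣
    R2  : ∀ {X Y} (x : X ∈ᶠ 𝓒) (y : Y ∈ᶠ 𝓒) → X ⊆ Y → rank X x ≤ rank Y y
    R3  : ∀ {X Y} (x : X ∈ᶠ 𝓒) (y : Y ∈ᶠ 𝓒) (xy : X ∪ Y ∈ᶠ 𝓒) →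
          rank (X ∪ Y) xy + rank (X ∩ Y) (complex (p∩q⊆p X Y) x)
            ≤ rank X x + rank Y y
    CR1 : ∀ {X Y} (x : X ∈ᶠ 𝓒) (y : Y ∈ᶠ 𝓒) →
          rank X x ≡ rank (X ∩ Y) (complex (p∩q⊆p X Y) x) → X ∪ Y ∈ᶠ 𝓒
    CR2 : ∀ {X Y} (x : X ∈ᶠ 𝓒) (y : Y ∈ᶠ 𝓒) → rank X x < rank Y y →
          ∃ λ e → e ∈ Y ─ X × X ∪ ⁅ e ⁆ ∈ᶠ 𝓒

record Matroid (n : ℕ) : Set where
  field
    rank : Subset n → ℕ
    R1   : ∀ X → rank X ≤ ∣ X ∣
    R2   : ∀ {X Y} → X ⊆ Y → rank X ≤ rank Y
    R3   : ∀ X Y → rank (X ∪ Y) + rank (X ∩ Y) ≤ rank X + rank Y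

open Matroid using (rank)

totalRank : ∀ {n} → Matroid n → ℕ
totalRank M = rank M ⊤

IsLoop : ∀ {n} → Matroid n → Fin n → Set
IsLoop M e = rank M ⁅ e ⁆ ≡ 0

-- Every element of the closure of F lies in F.
IsFlat : ∀ {n} → Matroid n → Subset n → Set
IsFlat M F = ∀ e → rank M (F ∪ ⁅ e ⁆) ≡ rank M F → e ∈ F

IsModularPair : ∀ {n} → Matroid n → Subset n → Subset n → Set
IsModularPair M X Y = rank M X + rank M Y ≡ rank M (X ∪ Y) + rank M (X ∩ Y)

record IsModularIdeal {n} (M : Matroid n) (𝓘 : Family n) : Set where
  field
    nonEmpty : NonEmpty 𝓘
    MI1 : IsSimplicialComplex 𝓘
    MI2 : ∀ e → ¬ IsLoop M e → ⁅ e ⁆ ∈ᶠ 𝓘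
    MI3 : ∀ {X Y} → X ∈ᶠ 𝓘 → Y ∈ᶠ 𝓘 → IsModularPair M X Y → X ∪ Y ∈ᶠ 𝓘

IsQuotientMap : ∀ {n} → Matroid n → Matroid n → Set
IsQuotientMap N M = ∀ F → IsFlat M F → IsFlat N F

IsElementaryQuotientMap : ∀ {n} → Matroid n → Matroid n → Set
IsElementaryQuotientMap N M =
  IsQuotientMap N M ×
  (totalRank N ≡ totalRank M ⊎ totalRank N ≡ suc (totalRank M))

IsElementaryPreimage : ∀ {n} → (M N : Matroid n) → Set
IsElementaryPreimage M N = IsElementaryQuotientMap N M

-- r_{M/p}(X) = r_M(X ∪ {p}) - r_M({p})
contractPt : ∀ {n} → Matroid (suc n) → Matroid n
contractPt {n} M = record
  { rank = r′
  ; R1   = λ X → m≤n+o⇒m∸n≤o (r (X ∪pt)) (r ⁅ pt ⁆) (size X)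
  ; R2   = λ X⊆Y → ∸-monoˡ-≤ (r ⁅ pt ⁆) (M.R2 (s⊆s X⊆Y))
  ; R3   = λ X Y → submodular X Y
  }
  where
  module M = Matroid M
  r = M.rank

  r′ : Subset n → ℕ
  r′ X = r (X ∪pt) ∸ r ⁅ pt ⁆

  size : ∀ X → r (X ∪pt) ≤ r ⁅ pt ⁆ + ∣ X ∣
  size X = begin
    r (X ∪pt)                                  ≡⟨ cong (λ Z → r (inside ∷ Z)) (∪-identityʳ X) ⟨
    r ((outside ∷ X) ∪ ⁅ pt ⁆)                 ≤⟨ m≤m+n _ _ ⟩
    r ((outside ∷ X) ∪ ⁅ pt ⁆) + r ((outside ∷ X) ∩ ⁅ pt ⁆)
                                               ≤⟨ M.R3 (outside ∷ X) ⁅ pt ⁆ ⟩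
    r (outside ∷ X) + r ⁅ pt ⁆                 ≤⟨ +-monoˡ-≤ (r ⁅ pt ⁆) (M.R1 (outside ∷ X)) ⟩
    ∣ X ∣ + r ⁅ pt ⁆                           ≡⟨ +-comm ∣ X ∣ (r ⁅ pt ⁆) ⟩
    r ⁅ pt ⁆ + ∣ X ∣                           ∎
    where open ≤-Reasoning

  split : ∀ X → r (X ∪pt) ≡ r′ X + r ⁅ pt ⁆
  split X = sym (m∸n+n≡m (M.R2 (s⊆s ⊥⊆)))

  interchange : ∀ a b c → (a + c) + (b + c) ≡ (a + b) + (c + c)
  interchange a b c = trans (+-assoc a c (b + c))
    (trans (cong (a +_) (trans (sym (+-assoc c b c))
      (trans (cong (_+ c) (+-comm c b)) (+-assoc b c c))))
    (sym (+-assoc a b (c + c))))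

  submodular : ∀ X Y → r′ (X ∪ Y) + r′ (X ∩ Y) ≤ r′ X + r′ Y
  submodular X Y = +-cancelʳ-≤ (c + c) _ _ (begin
    r′ (X ∪ Y) + r′ (X ∩ Y) + (c + c)          ≡⟨ interchange (r′ (X ∪ Y)) (r′ (X ∩ Y)) c ⟨
    (r′ (X ∪ Y) + c) + (r′ (X ∩ Y) + c)        ≡⟨ cong₂ _+_ (split (X ∪ Y)) (split (X ∩ Y)) ⟨
    r ((X ∪ Y) ∪pt) + r ((X ∩ Y) ∪pt)          ≤⟨ M.R3 (X ∪pt) (Y ∪pt) ⟩
    r (X ∪pt) + r (Y ∪pt)                      ≡⟨ cong₂ _+_ (split X) (split Y) ⟩
    (r′ X + c) + (r′ Y + c)                    ≡⟨ interchange (r′ X) (r′ Y) c ⟩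
    r′ X + r′ Y + (c + c)                      ∎)
    where
    open ≤-Reasoning
    c = r ⁅ pt ⁆

-- Matroids are equal when their rank functions agree.
matroidSetoid : ℕ → Setoid 0ℓ 0ℓ
matroidSetoid n = On.setoid (Subset n →-setoid ℕ) (rank {n})

_≈ᴹ_ : ∀ {n} → Matroid n → Matroid n → Set
_≈ᴹ_ {n} = Setoid._≈_ (matroidSetoid n)

infix 4 _≈ᴹ_

IsCoextension : ∀ {n} → Matroid n → Matroid (suc n) → Set
IsCoextension M Ñ = M ≈ᴹ contractPt Ñ

IsRankIncreasingCoextension : ∀ {n} → Matroid n → Matroid (suc n) → Set
IsRankIncreasingCoextension M Ñ = IsCoextension M Ñ × totalRank Ñ > totalRank M

-- The subset {a ∈ A | P a}, whose equality ignores the proofs of P.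
SubSetoid : (A : Setoid 0ℓ 0ℓ) → (Setoid.Carrier A → Set) → Setoid 0ℓ 0ℓ
SubSetoid A P = On.setoid {B = Σ (Setoid.Carrier A) P} A proj₁

-- Semimatroids are equal when they have the same complex and the same rank
-- function on it.
Semimat : ℕ → Setoid 0ℓ 0ℓ
Semimat n = record
  { Carrier = Semimatroid n
  ; _≈_     = λ A B →
      (∀ X → 𝓒 A X ≡ 𝓒 B X) ×
      (∀ X .(a : X ∈ᶠ 𝓒 A) .(b : X ∈ᶠ 𝓒 B) → r A X a ≡ r B X b)
  ; isEquivalence = record
      { refl  = (λ _ → refl) , (λ _ _ _ → refl)
      ; sym   = λ (p , q) → (λ X → sym (p X)) , (λ X b a → sym (q X a b))
      ; trans = λ (p , q) (p′ , q′) →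
          (λ X → trans (p X) (p′ X)) ,
          (λ X a c → trans (q X a (subst T (p X) a)) (q′ X (subst T (p X) a) c))
      }
  }
  where open Semimatroid renaming (rank to r)

MatId : ℕ → Setoid 0ℓ 0ℓ
MatId n = SubSetoid (matroidSetoid n ×ₛ (Subset n →-setoid Bool))
                    (λ (M , 𝓘) → IsModularIdeal M 𝓘)

MatPreim : ℕ → Setoid 0ℓ 0ℓ
MatPreim n = SubSetoid (matroidSetoid n ×ₛ matroidSetoid n)
                       (λ (M , N) → IsElementaryPreimage M N)

MatCoext : ℕ → Setoid 0ℓ 0ℓ
MatCoext n = SubSetoid (matroidSetoid n ×ₛ matroidSetoid (suc n))
                       (λ (M , Ñ) → IsRankIncreasingCoextension M Ñ)

pointedMatroidSetoid : ℕ → Setoid 0ℓ 0ℓ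
pointedMatroidSetoid m = matroidSetoid m ×ₛ setoid (Fin m)

Pointedmat : ℕ → Setoid 0ℓ 0ℓ
Pointedmat n = SubSetoid (pointedMatroidSetoid (suc n))
                         (λ (M , q) → q ≡ pt × ¬ IsLoop M q)

{-# OPTIONS --safe #-}

-- All five structures are encodings of one pair M, N of matroids on S: the
-- pointed matroid on S ∪ {p} has rank r_N X on X and r_M X + 1 on X ∪ {p}; the
-- modular ideal consists of the X with r_N X = r_M X, so that
-- r_N X = r_M X + [X ∉ 𝓘]; the semimatroid is the restriction of r_M to the
-- ideal.  It determines M, since in a semimatroid every member inside W extends
-- to a member of maximal rank inside W, whence
-- r_M X = max { r_C Y | Y ⊆ X, Y ∈ 𝓒 } is submodular; conversely, a modular ideal
-- contains a basis of every set.
module Submission where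

open import Defs
open import Algebra.Properties.CommutativeSemigroup using (interchange)
open import Data.Bool.Base using (Bool; true; false; T)
open import Data.Fin.Base using (zero; suc)
open import Data.Fin.Properties using (all?; ¬∀⟶∃¬)
open import Data.Fin.Subset
  using (Subset; inside; outside; ⊥; ⊤; ⁅_⁆; _∈_; _∉_; _⊆_; _⊂_; _⊃_; _∪_; _∩_; _─_; ∣_∣)
open import Data.Fin.Subset.Induction using (Acc; acc; ⊃-wellFounded)
open import Data.Fin.Subset.Properties
open import Data.Nat.Base
open import Data.Nat.Properties
open import Data.Product.Base using (∃; _×_; _,_; proj₁; proj₂)
open import Data.Sum.Base using (_⊎_; inj₁; inj₂)
open import Data.Unit.Base using (tt)
open import Data.Vec.Base using ([]; _∷_; here; there)
open import Function.Base using (_∘_; id)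
open import Function.Bundles using (Inverse)
import Function.Consequences.Setoid as Consequences
open import Function.Definitions
  using (Congruent; StrictlyInverseˡ; StrictlyInverseʳ)
open import Level using (0ℓ)
open import Relation.Binary.Bundles using (Setoid)
open import Relation.Binary.PropositionalEquality
  using (_≡_; refl; sym; trans; cong; cong₂; subst)
open import Relation.Nullary.Decidable
  using (yes; no; T?; recompute; decidable-stable; _→-dec_)
open import Relation.Nullary.Negation using (¬_; contradiction)

private
  variable
    n : ℕ
    X Y Z : Subset n

-- Subsets of a finite set

∪-least : X ⊆ Z → Y ⊆ Z → X ∪ Y ⊆ Z
∪-least {X = X} {Y = Y} X⊆Z Y⊆Z e∈ with x∈p∪q⁻ X Y e∈
... | inj₁ e∈X = X⊆Z e∈X
... | inj₂ e∈Y = Y⊆Z e∈Y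

∩-greatest : X ⊆ Y → X ⊆ Z → X ⊆ Y ∩ Z
∩-greatest X⊆Y X⊆Z e∈ = x∈p∩q⁺ (X⊆Y e∈ , X⊆Z e∈)

∪-monoˡ : X ⊆ Y → X ∪ Z ⊆ Y ∪ Z
∪-monoˡ {Y = Y} {Z = Z} X⊆Y =
  ∪-least (⊆-trans X⊆Y (p⊆p∪q Z)) (q⊆p∪q Y Z)

x∈p⇒⁅x⁆⊆p : ∀ {e} → e ∈ X → ⁅ e ⁆ ⊆ X
x∈p⇒⁅x⁆⊆p {X = X} {e} e∈X f∈ = subst (_∈ X) (sym (x∈⁅y⁆⇒x≡y e f∈)) e∈X

insert-⊂ : ∀ {e} → e ∉ X → X ⊂ X ∪ ⁅ e ⁆
insert-⊂ {X = X} {e} e∉X =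
  p⊆p∪q {p = X} ⁅ e ⁆ , e , q⊆p∪q X ⁅ e ⁆ (x∈⁅x⁆ e) , e∉X

x∈p─q⇒x∉q : ∀ (X Y : Subset n) {e} → e ∈ X ─ Y → e ∉ Y
x∈p─q⇒x∉q (_ ∷ X) (outside ∷ Y) (there e∈) (there e∈Y) = x∈p─q⇒x∉q X Y e∈ e∈Y
x∈p─q⇒x∉q (_ ∷ X) (inside  ∷ Y) (there e∈) (there e∈Y) = x∈p─q⇒x∉q X Y e∈ e∈Y

-- Recursion on the vector handles the tail first with `zero` absent, then inserts `zero` last if it
-- belongs to the set.
subset-induction : (P : Subset n → Set) → P ⊥ →
                   (∀ X e → P X → P (X ∪ ⁅ e ⁆)) → ∀ X → P X
subset-induction P base step [] = base
subset-induction P base step (s ∷ X) = extend s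
  where
  P-outside : P (outside ∷ X)
  P-outside = subset-induction (P ∘ (outside ∷_)) base
    (λ Y e → step (outside ∷ Y) (suc e)) X

  extend : ∀ s → P (s ∷ X)
  extend outside = P-outside
  extend inside  = subst (P ∘ (inside ∷_)) (∪-identityʳ X)
    (step (outside ∷ X) zero P-outside)

-- Matroids

module MatroidProperties (M : Matroid n) where
  open Matroid M public
  open ≤-Reasoning

  -- `R3` with monotonicity built in, so that applications need inclusions instead of equalities of
  -- sets.
  submodular : ∀ {U L} X Y → U ⊆ X ∪ Y → L ⊆ X → L ⊆ Y →
               rank U + rank L ≤ rank X + rank Y
  submodular X Y U⊆ L⊆X L⊆Y =
    ≤-trans (+-mono-≤ (R2 U⊆) (R2 (∩-greatest L⊆X L⊆Y))) (R3 X Y)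

  rank-⊥ : rank ⊥ ≡ 0
  rank-⊥ = n≤0⇒n≡0 (subst (rank ⊥ ≤_) (∣⊥∣≡0 n) (R1 ⊥))

  rank-⁅⁆ : ∀ e → rank ⁅ e ⁆ ≤ 1
  rank-⁅⁆ e = subst (rank ⁅ e ⁆ ≤_) (∣⁅x⁆∣≡1 e) (R1 ⁅ e ⁆)

  rank-∪ : ∀ X Y → rank (X ∪ Y) ≤ rank X + rank Y
  rank-∪ X Y = ≤-trans (m≤m+n _ _) (R3 X Y)

  -- Diminishing returns: `e` raises the rank of the larger set by no more than that of the smaller.
  -- Additive form avoids truncated subtraction.
  rank-insert : ∀ X Y e → X ⊆ Y →
                rank (Y ∪ ⁅ e ⁆) + rank X ≤ rank Y + rank (X ∪ ⁅ e ⁆)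
  rank-insert X Y e X⊆Y = submodular Y (X ∪ ⁅ e ⁆)
    (∪-least (p⊆p∪q _) (⊆-trans (q⊆p∪q X ⁅ e ⁆) (q⊆p∪q Y _))) X⊆Y (p⊆p∪q _)

  spans-mono : ∀ e → X ⊆ Y → rank (X ∪ ⁅ e ⁆) ≤ rank X →
               rank (Y ∪ ⁅ e ⁆) ≤ rank Y
  spans-mono {X} {Y} e X⊆Y spans = +-cancelʳ-≤ (rank X) _ _
    (≤-trans (rank-insert X Y e X⊆Y) (+-monoʳ-≤ (rank Y) spans))

  -- If no element of `Y` raised the rank of `X`, inserting them one by one would never raise it, by
  -- `spans-mono`, and `X ∪ Y` would have the rank of `X`.
  augment : ∀ X Y → rank X < rank Y →
            ∃ λ e → e ∈ Y ─ X × rank X < rank (X ∪ ⁅ e ⁆)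
  augment X Y rX<rY = conclude (subset-induction P base step Y)
    where
    P : Subset n → Set
    P Z = rank (X ∪ Z) ≤ rank X ⊎
          (∃ λ e → e ∈ Z × rank X < rank (X ∪ ⁅ e ⁆))

    base : P ⊥
    base = inj₁ (≤-reflexive (cong rank (∪-identityʳ X)))

    step : ∀ Z e → P Z → P (Z ∪ ⁅ e ⁆)
    step Z e (inj₂ (f , f∈Z , lt)) = inj₂ (f , p⊆p∪q _ f∈Z , lt)
    step Z e (inj₁ le) with rank (X ∪ ⁅ e ⁆) ≤? rank X
    ... | no ¬le = inj₂ (e , q⊆p∪q Z ⁅ e ⁆ (x∈⁅x⁆ e) , ≰⇒> ¬le)
    ... | yes spans = inj₁ (begin
      rank (X ∪ (Z ∪ ⁅ e ⁆))  ≡⟨ cong rank (∪-assoc X Z ⁅ e ⁆) ⟨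
      rank ((X ∪ Z) ∪ ⁅ e ⁆)  ≤⟨ spans-mono e (p⊆p∪q Z) spans ⟩
      rank (X ∪ Z)            ≤⟨ le ⟩
      rank X                  ∎)

    conclude : P Y → ∃ λ e → e ∈ Y ─ X × rank X < rank (X ∪ ⁅ e ⁆)
    conclude (inj₁ le) =
      contradiction (≤-trans (R2 (q⊆p∪q X Y)) le) (<⇒≱ rX<rY)
    conclude (inj₂ (e , e∈Y , lt)) = e , x∈p∧x∉q⇒x∈p─q e∈Y e∉X , lt
      where
      e∉X : e ∉ X
      e∉X e∈X = <⇒≱ lt (R2 (∪-least ⊆-refl (x∈p⇒⁅x⁆⊆p e∈X)))

  -- Elements that leave the rank unchanged are added until none is left outside; the set grows
  -- strictly, so this stops.
  flat-hull : ∀ X → ∃ λ F → X ⊆ F × rank F ≡ rank X × IsFlat M F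
  flat-hull X = go X (⊃-wellFounded X) ⊆-refl refl
    where
    go : ∀ F → Acc _⊃_ F → X ⊆ F → rank F ≡ rank X →
         ∃ λ F → X ⊆ F × rank F ≡ rank X × IsFlat M F
    go F (acc rec) X⊆F eq
      with all? (λ e → (rank (F ∪ ⁅ e ⁆) ≟ rank F) →-dec (e ∈? F))
    ... | yes flat = F , X⊆F , eq , flat
    ... | no ¬flat with ¬∀⟶∃¬ _ _
          (λ e → (rank (F ∪ ⁅ e ⁆) ≟ rank F) →-dec (e ∈? F)) ¬flat
    ...   | e , ¬closed = go (F ∪ ⁅ e ⁆)
            (rec (insert-⊂ e∉F))
            (⊆-trans X⊆F (p⊆p∪q _)) (trans spans eq)
      where
      e∉F : e ∉ F
      e∉F e∈F = ¬closed (λ _ → e∈F)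

      spans : rank (F ∪ ⁅ e ⁆) ≡ rank F
      spans = decidable-stable (_ ≟ _) (λ ¬eq → ¬closed (λ eq → contradiction eq ¬eq))

-- Quotient maps and elementary preimages

module QuotientProperties (M N : Matroid n) (quotient : IsQuotientMap N M) where
  private
    module M = MatroidProperties M
    module N = MatroidProperties N
  open ≤-Reasoning

  -- The flat of `M` spanned by `X` is also a flat of `N`, so it contains every `e` that `X` spans
  -- in `N`.
  spans-quotient : ∀ X e → N.rank (X ∪ ⁅ e ⁆) ≤ N.rank X →
                   M.rank (X ∪ ⁅ e ⁆) ≤ M.rank X
  spans-quotient X e spans with M.flat-hull X
  ... | F , X⊆F , rF≡rX , flat = subst (M.rank (X ∪ ⁅ e ⁆) ≤_) rF≡rX
    (M.R2 (∪-least X⊆F (x∈p⇒⁅x⁆⊆p e∈F)))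
    where
    e∈F : e ∈ F
    e∈F = quotient F flat e
      (≤-antisym (N.spans-mono e X⊆F spans) (N.R2 (p⊆p∪q _)))

  -- Either `e` is spanned in `N`, hence in `M`, or the rank in `N` rises by at least 1 while that
  -- in `M` rises by at most 1.
  rank-insert-quotient : ∀ X e → N.rank X + M.rank (X ∪ ⁅ e ⁆) ≤
                                 N.rank (X ∪ ⁅ e ⁆) + M.rank X
  rank-insert-quotient X e with N.rank (X ∪ ⁅ e ⁆) ≤? N.rank X
  ... | yes spans = +-mono-≤ (N.R2 (p⊆p∪q _)) (spans-quotient X e spans)
  ... | no ¬spans = begin
    N.rank X + M.rank (X ∪ ⁅ e ⁆)         ≤⟨ +-monoʳ-≤ _ (M.rank-∪ X ⁅ e ⁆) ⟩
    N.rank X + (M.rank X + M.rank ⁅ e ⁆)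
      ≤⟨ +-monoʳ-≤ (N.rank X) (+-monoʳ-≤ (M.rank X) (M.rank-⁅⁆ e)) ⟩
    N.rank X + (M.rank X + 1)             ≡⟨ cong (N.rank X +_) (+-comm _ 1) ⟩
    N.rank X + suc (M.rank X)             ≡⟨ +-suc _ _ ⟩
    suc (N.rank X) + M.rank X             ≤⟨ +-monoˡ-≤ _ (≰⇒> ¬spans) ⟩
    N.rank (X ∪ ⁅ e ⁆) + M.rank X         ∎

  -- In subtractive terms, r_N - r_M is monotone. It suffices to sum the one-element case along a
  -- chain from `X` to `Y`.
  rank-quotient : X ⊆ Y → N.rank X + M.rank Y ≤ N.rank Y + M.rank X
  rank-quotient {X} {Y} X⊆Y =
    -- The chain inserts the elements of `Y` into `X` and ends at `X ∪ Y`, which is `Y`.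
    subst P (⊆-antisym (∪-least X⊆Y ⊆-refl) (q⊆p∪q X Y))
      (subset-induction (P ∘ (X ∪_)) base step Y)
    where
    P : Subset n → Set
    P Z = N.rank X + M.rank Z ≤ N.rank Z + M.rank X

    base : P (X ∪ ⊥)
    base = subst P (sym (∪-identityʳ X)) ≤-refl

    step : ∀ Z e → P (X ∪ Z) → P (X ∪ (Z ∪ ⁅ e ⁆))
    step Z e ih = subst P (∪-assoc X Z ⁅ e ⁆)
      (+-cancelʳ-≤ (M.rank V + N.rank V) _ _ (begin
        N.rank X + M.rank Ve + (M.rank V + N.rank V)
          ≡⟨ interchange +-commutativeSemigroup (N.rank X) _ _ _ ⟩
        N.rank X + M.rank V + (M.rank Ve + N.rank V)
          ≡⟨ cong (N.rank X + M.rank V +_) (+-comm (M.rank Ve) _) ⟩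
        N.rank X + M.rank V + (N.rank V + M.rank Ve)
          ≤⟨ +-mono-≤ ih (rank-insert-quotient V e) ⟩
        N.rank V + M.rank X + (N.rank Ve + M.rank V)
          ≡⟨ +-comm (N.rank V + M.rank X) _ ⟩
        N.rank Ve + M.rank V + (N.rank V + M.rank X)
          ≡⟨ cong (N.rank Ve + M.rank V +_) (+-comm (N.rank V) _) ⟩
        N.rank Ve + M.rank V + (M.rank X + N.rank V)
          ≡⟨ interchange +-commutativeSemigroup (N.rank Ve) _ _ _ ⟩
        N.rank Ve + M.rank X + (M.rank V + N.rank V)    ∎))
      where
      V  = X ∪ Z
      Ve = V ∪ ⁅ e ⁆

module PreimageProperties (M N : Matroid n)
                          (preimage : IsElementaryPreimage M N) where
  private
    module M = MatroidProperties M
    module N = MatroidProperties N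
  open QuotientProperties M N (proj₁ preimage) public
  open ≤-Reasoning

  rank≤preimage : ∀ X → M.rank X ≤ N.rank X
  rank≤preimage X = begin
    M.rank X               ≤⟨ m≤n+m _ (N.rank ⊥) ⟩
    N.rank ⊥ + M.rank X    ≤⟨ rank-quotient ⊥⊆ ⟩
    N.rank X + M.rank ⊥    ≡⟨ cong (N.rank X +_) M.rank-⊥ ⟩
    N.rank X + 0           ≡⟨ +-identityʳ _ ⟩
    N.rank X               ∎

  total≤suc : totalRank N ≤ suc (totalRank M)
  total≤suc with proj₂ preimage
  ... | inj₁ eq = ≤-trans (≤-reflexive eq) (n≤1+n _)
  ... | inj₂ eq = ≤-reflexive eq

  -- The monotone difference r_N - r_M is largest at `⊤`, where it is at most 1.
  preimage≤suc : ∀ X → N.rank X ≤ suc (M.rank X)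
  preimage≤suc X = +-cancelʳ-≤ (totalRank M) _ _ (begin
    N.rank X + totalRank M          ≤⟨ rank-quotient ⊆⊤ ⟩
    totalRank N + M.rank X          ≤⟨ +-monoˡ-≤ _ total≤suc ⟩
    suc (totalRank M + M.rank X)    ≡⟨ cong suc (+-comm (totalRank M) _) ⟩
    suc (M.rank X) + totalRank M    ∎)

-- Modular ideals

module IdealProperties (M : Matroid n) {𝓘 : Family n}
                       (ideal : IsModularIdeal M 𝓘) where
  open MatroidProperties M public
  open IsModularIdeal ideal public
  open ≤-Reasoning

  ⊥∈𝓘 : ⊥ ∈ᶠ 𝓘
  ⊥∈𝓘 = MI1 ⊥⊆ (proj₂ nonEmpty)

  -- An element that raises the rank is a non-loop and forms a modular pair with `Y`, so `MI2` and
  -- `MI3` apply.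
  insert-closed : ∀ Y e → Y ∈ᶠ 𝓘 → rank Y < rank (Y ∪ ⁅ e ⁆) → Y ∪ ⁅ e ⁆ ∈ᶠ 𝓘
  insert-closed Y e Y∈ lt = MI3 Y∈ (MI2 e ¬loop) (≤-antisym modular (R3 Y ⁅ e ⁆))
    where
    ¬loop : ¬ IsLoop M e
    ¬loop loop = <⇒≱ lt (begin
      rank (Y ∪ ⁅ e ⁆)       ≤⟨ rank-∪ Y ⁅ e ⁆ ⟩
      rank Y + rank ⁅ e ⁆    ≡⟨ cong (rank Y +_) loop ⟩
      rank Y + 0             ≡⟨ +-identityʳ _ ⟩
      rank Y                 ∎)

    modular : rank Y + rank ⁅ e ⁆ ≤ rank (Y ∪ ⁅ e ⁆) + rank (Y ∩ ⁅ e ⁆)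
    modular = begin
      rank Y + rank ⁅ e ⁆    ≤⟨ +-monoʳ-≤ (rank Y) (rank-⁅⁆ e) ⟩
      rank Y + 1             ≡⟨ +-comm _ 1 ⟩
      suc (rank Y)           ≤⟨ lt ⟩
      rank (Y ∪ ⁅ e ⁆)       ≤⟨ m≤m+n _ _ ⟩
      rank (Y ∪ ⁅ e ⁆) + rank (Y ∩ ⁅ e ⁆) ∎

  -- Greedy construction: each new element of `X` is spanned by the member found so far or can be
  -- added to it by `insert-closed`.
  spanning-member : ∀ X → ∃ λ Y → Y ∈ᶠ 𝓘 × Y ⊆ X × rank X ≤ rank Y
  spanning-member = subset-induction P (⊥ , ⊥∈𝓘 , ⊆-refl , ≤-refl) step
    where
    P : Subset n → Set
    P X = ∃ λ Y → Y ∈ᶠ 𝓘 × Y ⊆ X × rank X ≤ rank Y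

    step : ∀ X e → P X → P (X ∪ ⁅ e ⁆)
    step X e (Y , Y∈ , Y⊆X , rX≤rY) with rank (Y ∪ ⁅ e ⁆) ≤? rank Y
    ... | yes spans = Y , Y∈ , ⊆-trans Y⊆X (p⊆p∪q _) ,
                      ≤-trans (spans-mono e Y⊆X spans) rX≤rY
    ... | no ¬spans = Y ∪ ⁅ e ⁆ , insert-closed Y e Y∈ (≰⇒> ¬spans) , ∪-monoˡ Y⊆X ,
      +-cancelʳ-≤ (rank Y) _ _ (begin
        rank (X ∪ ⁅ e ⁆) + rank Y    ≤⟨ rank-insert Y X e Y⊆X ⟩
        rank X + rank (Y ∪ ⁅ e ⁆)    ≤⟨ +-monoˡ-≤ _ rX≤rY ⟩
        rank Y + rank (Y ∪ ⁅ e ⁆)    ≡⟨ +-comm (rank Y) _ ⟩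
        rank (Y ∪ ⁅ e ⁆) + rank Y    ∎)

  -- A spanning member inside `X` must be a proper subset, since `X` is not a member, and its size
  -- already bounds the rank.
  nonmember-dependent : ∀ X → ¬ (X ∈ᶠ 𝓘) → rank X < ∣ X ∣
  nonmember-dependent X X∉ with spanning-member X
  ... | Y , Y∈ , Y⊆X , rX≤rY with X ⊆? Y
  ...   | yes X⊆Y = contradiction (MI1 X⊆Y Y∈) X∉
  ...   | no X⊈Y = ≤-<-trans (≤-trans rX≤rY (R1 Y)) (≰⇒> λ ∣X∣≤∣Y∣ → X⊈Y (X⊆Y ∣X∣≤∣Y∣))
    where
    X⊆Y : ∣ X ∣ ≤ ∣ Y ∣ → X ⊆ Y
    X⊆Y ∣X∣≤∣Y∣ {e} e∈X with e ∈? Y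
    ... | yes e∈Y = e∈Y
    ... | no  e∉Y =
      contradiction ∣X∣≤∣Y∣ (<⇒≱ (p⊂q⇒∣p∣<∣q∣ (Y⊆X , e , e∈X , e∉Y)))

-- Semimatroids

maxRank : (Subset n → ℕ) → Subset n → ℕ
maxRank f []            = f []
maxRank f (outside ∷ X) = maxRank (f ∘ (outside ∷_)) X
maxRank f (inside  ∷ X) =
  maxRank (f ∘ (outside ∷_)) X ⊔ maxRank (f ∘ (inside ∷_)) X

maxRank-upper : (f : Subset n → ℕ) → ∀ Y X → Y ⊆ X → f Y ≤ maxRank f X
maxRank-upper f [] [] _ = ≤-refl
maxRank-upper f (outside ∷ Y) (outside ∷ X) Y⊆X =
  maxRank-upper _ Y X (drop-∷-⊆ Y⊆X)
maxRank-upper f (inside  ∷ Y) (outside ∷ X) Y⊆X with () ← Y⊆X here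
maxRank-upper f (outside ∷ Y) (inside  ∷ X) Y⊆X =
  ≤-trans (maxRank-upper _ Y X (drop-∷-⊆ Y⊆X)) (m≤m⊔n _ _)
maxRank-upper f (inside  ∷ Y) (inside  ∷ X) Y⊆X =
  ≤-trans (maxRank-upper _ Y X (drop-∷-⊆ Y⊆X)) (m≤n⊔m _ _)

maxRank-attained : (f : Subset n → ℕ) → ∀ X → ∃ λ Y → Y ⊆ X × f Y ≡ maxRank f X
maxRank-attained f [] = [] , id , refl
maxRank-attained f (outside ∷ X) with maxRank-attained (f ∘ (outside ∷_)) X
... | Y , Y⊆X , eq = outside ∷ Y , out⊆ Y⊆X , eq
maxRank-attained f (inside ∷ X)
  with maxRank-attained (f ∘ (outside ∷_)) X | maxRank-attained (f ∘ (inside ∷_)) X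
     | ⊔-sel (maxRank (f ∘ (outside ∷_)) X) (maxRank (f ∘ (inside ∷_)) X)
... | Y , Y⊆X , eq | _ | inj₁ sel = outside ∷ Y , out⊆ Y⊆X , trans eq (sym sel)
... | _ | Y , Y⊆X , eq | inj₂ sel = inside ∷ Y , in⊆in Y⊆X , trans eq (sym sel)

maxRank-cong : {f g : Subset n → ℕ} → (∀ X → f X ≡ g X) →
               ∀ X → maxRank f X ≡ maxRank g X
maxRank-cong f≗g []            = f≗g []
maxRank-cong f≗g (outside ∷ X) = maxRank-cong (f≗g ∘ (outside ∷_)) X
maxRank-cong f≗g (inside  ∷ X) =
  cong₂ _⊔_ (maxRank-cong (f≗g ∘ (outside ∷_)) X)
            (maxRank-cong (f≗g ∘ (inside  ∷_)) X)

module SemimatroidProperties (C : Semimatroid n) where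
  open Semimatroid C public
  open ≤-Reasoning

  ⊥∈𝓒 : ⊥ ∈ᶠ 𝓒
  ⊥∈𝓒 = complex ⊥⊆ (proj₂ nonEmpty)

  rank-⊥ : rank ⊥ ⊥∈𝓒 ≡ 0
  rank-⊥ = n≤0⇒n≡0 (subst (rank ⊥ ⊥∈𝓒 ≤_) (∣⊥∣≡0 n) (R1 ⊥∈𝓒))

  submodular : ∀ {X Y U L} (x : X ∈ᶠ 𝓒) (y : Y ∈ᶠ 𝓒) (u : U ∈ᶠ 𝓒) (l : L ∈ᶠ 𝓒) →
               X ∪ Y ∈ᶠ 𝓒 → U ⊆ X ∪ Y → L ⊆ X → L ⊆ Y →
               rank U u + rank L l ≤ rank X x + rank Y y
  submodular {X} {Y} x y u l xy U⊆ L⊆X L⊆Y = ≤-trans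
    (+-mono-≤ (R2 u xy U⊆)
              (R2 l (complex (p∩q⊆p X Y) x) (∩-greatest L⊆X L⊆Y)))
    (R3 x y xy)

  -- 0 on non-members, which does not affect maxima since rank ⊥ is 0 too.
  rankOrZero : Subset n → ℕ
  rankOrZero X with T? (𝓒 X)
  ... | yes x = rank X x
  ... | no _  = 0

  rankOrZero-member : ∀ X (x : X ∈ᶠ 𝓒) → rankOrZero X ≡ rank X x
  rankOrZero-member X x with T? (𝓒 X)
  ... | yes _ = refl
  ... | no ¬x = contradiction x ¬x

  rankOrZero-nonmember : ∀ X → ¬ (X ∈ᶠ 𝓒) → rankOrZero X ≡ 0
  rankOrZero-nonmember X ¬x with T? (𝓒 X)
  ... | yes x = contradiction x ¬x
  ... | no _  = refl

  hullRank : Subset n → ℕ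
  hullRank = maxRank rankOrZero

  hullRank-upper : ∀ {X Y} (y : Y ∈ᶠ 𝓒) → Y ⊆ X → rank Y y ≤ hullRank X
  hullRank-upper {X} {Y} y Y⊆X =
    subst (_≤ hullRank X) (rankOrZero-member Y y) (maxRank-upper rankOrZero Y X Y⊆X)

  hullRank-attained : ∀ X → ∃ λ Y → ∃ λ (y : Y ∈ᶠ 𝓒) → Y ⊆ X × rank Y y ≡ hullRank X
  hullRank-attained X with maxRank-attained rankOrZero X
  ... | Y , Y⊆X , eq with T? (𝓒 Y)
  ...   | yes y = Y , y , Y⊆X , eq
  -- The maximum is then the default value 0, which the member `⊥` attains too.
  ...   | no ¬y = ⊥ , ⊥∈𝓒 , ⊥⊆ , trans rank-⊥ eq

  hullRank-member : ∀ X (x : X ∈ᶠ 𝓒) → hullRank X ≡ rank X x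
  hullRank-member X x with hullRank-attained X
  ... | Y , y , Y⊆X , eq =
    ≤-antisym (subst (_≤ rank X x) eq (R2 y x Y⊆X)) (hullRank-upper x ⊆-refl)

  -- While the rank is not maximal in `W`, `CR2` against a member of maximal rank inside `W`
  -- supplies a further element of `W`.
  extend : ∀ {A W} → A ∈ᶠ 𝓒 → A ⊆ W →
           ∃ λ D → ∃ λ (d : D ∈ᶠ 𝓒) → A ⊆ D × D ⊆ W × rank D d ≡ hullRank W
  extend {A} {W} a A⊆W = go A a (⊃-wellFounded A) ⊆-refl A⊆W
    where
    go : ∀ B (b : B ∈ᶠ 𝓒) → Acc _⊃_ B → A ⊆ B → B ⊆ W →
         ∃ λ D → ∃ λ (d : D ∈ᶠ 𝓒) → A ⊆ D × D ⊆ W × rank D d ≡ hullRank W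
    go B b (acc rec) A⊆B B⊆W with hullRank W ≤? rank B b
    ... | yes le = B , b , A⊆B , B⊆W , ≤-antisym (hullRank-upper b B⊆W) le
    ... | no ¬le with hullRank-attained W
    ...   | Y , y , Y⊆W , eq with CR2 b y (subst (rank B b <_) (sym eq) (≰⇒> ¬le))
    ...     | e , e∈Y─B , Be∈ = go (B ∪ ⁅ e ⁆) Be∈
      (rec (insert-⊂ (x∈p─q⇒x∉q Y B e∈Y─B)))
      (⊆-trans A⊆B (p⊆p∪q _))
      (∪-least B⊆W (x∈p⇒⁅x⁆⊆p (Y⊆W (p─q⊆p Y B e∈Y─B))))

  hullRank≤size : ∀ X → hullRank X ≤ ∣ X ∣
  hullRank≤size X with hullRank-attained X
  ... | Y , y , Y⊆X , eq = subst (_≤ ∣ X ∣) eq (≤-trans (R1 y) (p⊆q⇒∣p∣≤∣q∣ Y⊆X))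

  hullRank-mono : X ⊆ Y → hullRank X ≤ hullRank Y
  hullRank-mono {X} {Y} X⊆Y with hullRank-attained X
  ... | Z , z , Z⊆X , eq =
    subst (_≤ hullRank Y) eq (hullRank-upper z (⊆-trans Z⊆X X⊆Y))

  -- A member `A` of maximal rank in `X ∩ Y` extends to a member `D` of maximal rank in `X ∪ Y`.
  -- `R3` is applied to `D ∩ X` and `D ∩ Y`, whose union is `D` and whose intersection contains `A`.
  hullRank-submodular : ∀ X Y → hullRank (X ∪ Y) + hullRank (X ∩ Y) ≤
                                hullRank X + hullRank Y
  hullRank-submodular X Y with hullRank-attained (X ∩ Y)
  ... | A , a , A⊆X∩Y , eqA
    with extend a (⊆-trans A⊆X∩Y (⊆-trans (p∩q⊆p X Y) (p⊆p∪q Y)))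
  ...   | D , d , A⊆D , D⊆X∪Y , eqD = begin
    hullRank (X ∪ Y) + hullRank (X ∩ Y)    ≡⟨ cong₂ _+_ eqD eqA ⟨
    rank D d + rank A a
      ≤⟨ submodular DX∈ DY∈ d a (complex union⊆ d) ⊆union
           (∩-greatest A⊆D (⊆-trans A⊆X∩Y (p∩q⊆p X Y)))
           (∩-greatest A⊆D (⊆-trans A⊆X∩Y (p∩q⊆q X Y))) ⟩
    rank (D ∩ X) DX∈ + rank (D ∩ Y) DY∈
      ≤⟨ +-mono-≤ (hullRank-upper DX∈ (p∩q⊆q D X)) (hullRank-upper DY∈ (p∩q⊆q D Y)) ⟩
    hullRank X + hullRank Y                ∎
    where
    DX∈ : D ∩ X ∈ᶠ 𝓒
    DX∈ = complex (p∩q⊆p D X) d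

    DY∈ : D ∩ Y ∈ᶠ 𝓒
    DY∈ = complex (p∩q⊆p D Y) d

    union⊆ : (D ∩ X) ∪ (D ∩ Y) ⊆ D
    union⊆ = ∪-least (p∩q⊆p D X) (p∩q⊆p D Y)

    ⊆union : D ⊆ (D ∩ X) ∪ (D ∩ Y)
    ⊆union = subst (D ⊆_) (∩-distribˡ-∪ D X Y) (∩-greatest ⊆-refl D⊆X∪Y)

  hull : Matroid n
  hull = record
    { rank = hullRank
    ; R1   = hullRank≤size
    ; R2   = hullRank-mono
    ; R3   = hullRank-submodular
    }

  -- A member inside `⁅ e ⁆` that avoids `e` is empty and has rank 0, so positive rank forces a
  -- member containing `e`.
  nonloop∈𝓒 : ∀ e → ¬ IsLoop hull e → ⁅ e ⁆ ∈ᶠ 𝓒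
  nonloop∈𝓒 e ¬loop with hullRank-attained ⁅ e ⁆
  ... | Y , y , Y⊆e , eq with e ∈? Y
  ...   | yes e∈Y = complex (x∈p⇒⁅x⁆⊆p e∈Y) y
  ...   | no  e∉Y =
    contradiction (trans (sym eq) (n≤0⇒n≡0 rY≤0)) ¬loop
    where
    Y⊆⊥ : Y ⊆ ⊥
    Y⊆⊥ f∈Y = contradiction (subst (_∈ Y) (x∈⁅y⁆⇒x≡y e (Y⊆e f∈Y)) f∈Y) e∉Y

    rY≤0 : rank Y y ≤ 0
    rY≤0 = subst (rank Y y ≤_) rank-⊥ (R2 y ⊥∈𝓒 Y⊆⊥)

  -- CR1 applies to Y and a member D ⊇ X of full rank in X ∪ Y.
  modular-closed : X ∈ᶠ 𝓒 → Y ∈ᶠ 𝓒 → IsModularPair hull X Y → X ∪ Y ∈ᶠ 𝓒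
  modular-closed {X} {Y} x y modular with extend x (p⊆p∪q {p = X} Y)
  ... | D , d , X⊆D , D⊆X∪Y , eqD =
    complex (∪-least (⊆-trans X⊆D (q⊆p∪q Y D)) (p⊆p∪q D))
      (CR1 y d (≤-antisym rY≤ (R2 YD∈ y (p∩q⊆p Y D))))
    where
    YD∈ : Y ∩ D ∈ᶠ 𝓒
    YD∈ = complex (p∩q⊆p Y D) y

    XY∈ : X ∩ Y ∈ᶠ 𝓒
    XY∈ = complex (p∩q⊆p X Y) x

    ⊆union : D ⊆ X ∪ (Y ∩ D)
    ⊆union e∈D with x∈p∪q⁻ X Y (D⊆X∪Y e∈D)
    ... | inj₁ e∈X = p⊆p∪q _ e∈X
    ... | inj₂ e∈Y = q⊆p∪q X _ (x∈p∩q⁺ (e∈Y , e∈D))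

    rY≤ : rank Y y ≤ rank (Y ∩ D) YD∈
    -- Modularity of `X`, `Y` is compared with `R3` for `X` and `Y ∩ D`, whose union is `D` and
    -- whose intersection contains `X ∩ Y`.
    rY≤ = +-cancelˡ-≤ (rank X x) _ _ (begin
      rank X x + rank Y y
        ≡⟨ cong₂ _+_ (hullRank-member X x) (hullRank-member Y y) ⟨
      hullRank X + hullRank Y                ≡⟨ modular ⟩
      hullRank (X ∪ Y) + hullRank (X ∩ Y)
        ≡⟨ cong₂ _+_ (sym eqD) (hullRank-member (X ∩ Y) XY∈) ⟩
      rank D d + rank (X ∩ Y) XY∈
        ≤⟨ submodular x YD∈ d XY∈
             (complex (∪-least X⊆D (p∩q⊆q Y D)) d) ⊆union (p∩q⊆p X Y)
             (∩-greatest (p∩q⊆q X Y) (⊆-trans (p∩q⊆p X Y) X⊆D)) ⟩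
      rank X x + rank (Y ∩ D) YD∈            ∎)

  isModularIdeal : IsModularIdeal hull 𝓒
  isModularIdeal = record
    { nonEmpty = nonEmpty
    ; MI1 = complex
    ; MI2 = nonloop∈𝓒
    ; MI3 = modular-closed
    }

-- The hypothesis of `CR1` makes `X`, `Y` a modular pair, so `MI3` gives `CR1`. For `CR2`, matroid
-- augmentation yields an element that raises the rank, and inserting it stays in the ideal.
restrict : (M : Matroid n) {𝓘 : Family n} → IsModularIdeal M 𝓘 → Semimatroid n
restrict M {𝓘} ideal = record
  { 𝓒        = 𝓘
  ; complex  = MI1
  ; nonEmpty = nonEmpty
  ; rank     = λ X _ → rank X
  ; R1       = λ {X} _ → R1 X
  ; R2       = λ _ _ → R2
  ; R3       = λ {X} {Y} _ _ _ → R3 X Y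
  ; CR1      = λ {X} {Y} x y eq → MI3 x y (modular X Y eq)
  ; CR2      = λ {X} {Y} x _ lt →
      let e , e∈ , lt′ = augment X Y lt in e , e∈ , insert-closed X e x lt′
  }
  where
  open IdealProperties M ideal
  open ≤-Reasoning

  modular : ∀ X Y → rank X ≡ rank (X ∩ Y) → IsModularPair M X Y
  modular X Y eq = ≤-antisym
    (begin
      rank X + rank Y                ≤⟨ +-monoʳ-≤ _ (R2 (q⊆p∪q X Y)) ⟩
      rank X + rank (X ∪ Y)          ≡⟨ cong (_+ rank (X ∪ Y)) eq ⟩
      rank (X ∩ Y) + rank (X ∪ Y)    ≡⟨ +-comm (rank (X ∩ Y)) _ ⟩
      rank (X ∪ Y) + rank (X ∩ Y)    ∎)
    (R3 X Y)

-- Modular ideals and elementary preimages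

-- The value of r_N - r_M, read off from membership in the ideal.
offset : Bool → ℕ
offset true  = 0
offset false = 1

offset≤1 : ∀ b → offset b ≤ 1
offset≤1 true  = z≤n
offset≤1 false = ≤-refl

offset-anti : ∀ b c → (T c → T b) → offset b ≤ offset c
offset-anti true  _     _   = z≤n
offset-anti false false _   = ≤-refl
offset-anti false true  c⇒b = contradiction (c⇒b tt) id

-- The arguments `u`, `i`, `x`, `y` stand for membership of `X ∪ Y`, `X ∩ Y`, `X` and `Y`; the last
-- hypothesis is what `MI3` gives for a modular pair.
offset-modular : ∀ u i x y → (T x → T i) → (T y → T i) →
                 (T x → T y → T u) → offset u + offset i ≤ offset x + offset y
offset-modular u true  true  y _ _ xy⇒u =
  subst (_≤ offset y) (sym (+-identityʳ _)) (offset-anti u y (xy⇒u tt))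
offset-modular u false true  y x⇒i _ _ = contradiction (x⇒i tt) id
offset-modular u i false y _ y⇒i _ = +-mono-≤ (offset≤1 u) (offset-anti i y y⇒i)

-- For pairs that are not modular: the rank inequality is strict there, which pays for the `suc`.
offset-submodular : ∀ u i x y → (T x → T i) →
                    offset u + offset i ≤ suc (offset x + offset y)
offset-submodular u true  true y _ =
  subst (_≤ suc (offset y)) (sym (+-identityʳ _)) (≤-trans (offset≤1 u) (s≤s z≤n))
offset-submodular u false true y x⇒i = contradiction (x⇒i tt) id
offset-submodular u i false y _ =
  +-mono-≤ (offset≤1 u) (≤-trans (offset≤1 i) (s≤s z≤n))

≡ᵇ-offset : ∀ m b → (m + offset b ≡ᵇ m) ≡ b
≡ᵇ-offset zero    true  = refl
≡ᵇ-offset zero    false = refl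
≡ᵇ-offset (suc m) b     = ≡ᵇ-offset m b

offset-≡ᵇ : ∀ {k m} → m ≤ k → k ≤ suc m → m + offset (k ≡ᵇ m) ≡ k
offset-≡ᵇ {zero}     {zero}  _       _       = refl
offset-≡ᵇ {suc zero} {zero}  _       _       = refl
offset-≡ᵇ {suc (suc _)} {zero} _     (s≤s ())
offset-≡ᵇ {suc k}    {suc m} (s≤s p) (s≤s q) = cong suc (offset-≡ᵇ p q)

module IdealToPreimage (M : Matroid n) {𝓘 : Family n}
                       (ideal : IsModularIdeal M 𝓘) where
  open IdealProperties M ideal
  open ≤-Reasoning

  rank⁺ : Subset n → ℕ
  rank⁺ X = rank X + offset (𝓘 X)

  rank⁺≤size : ∀ X → rank⁺ X ≤ ∣ X ∣
  rank⁺≤size X with 𝓘 X in eq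
  ... | true  = subst (_≤ ∣ X ∣) (sym (+-identityʳ _)) (R1 X)
  -- A nonmember is dependent, which leaves room for the extra 1.
  ... | false = subst (_≤ ∣ X ∣) (+-comm 1 _) (nonmember-dependent X (subst T eq))

  rank⁺-mono : X ⊆ Y → rank⁺ X ≤ rank⁺ Y
  rank⁺-mono {X} {Y} X⊆Y = +-mono-≤ (R2 X⊆Y) (offset-anti (𝓘 X) (𝓘 Y) (MI1 X⊆Y))

  -- Either submodularity of `rank` is strict and its slack absorbs the offsets, or the pair is
  -- modular and the offsets are submodular by `MI3`.
  rank⁺-submodular : ∀ X Y → rank⁺ (X ∪ Y) + rank⁺ (X ∩ Y) ≤ rank⁺ X + rank⁺ Y
  rank⁺-submodular X Y = begin
    rank⁺ (X ∪ Y) + rank⁺ (X ∩ Y)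
      ≡⟨ interchange +-commutativeSemigroup (rank (X ∪ Y)) _ _ _ ⟩
    rank (X ∪ Y) + rank (X ∩ Y) + (offset (𝓘 (X ∪ Y)) + offset (𝓘 (X ∩ Y)))
      ≤⟨ combined (m≤n⇒m<n∨m≡n (R3 X Y)) ⟩
    rank X + rank Y + (offset (𝓘 X) + offset (𝓘 Y))
      ≡⟨ interchange +-commutativeSemigroup (rank X) _ _ _ ⟩
    rank⁺ X + rank⁺ Y    ∎
    where
    m = rank (X ∪ Y) + rank (X ∩ Y)
    k = rank X + rank Y
    d = offset (𝓘 (X ∪ Y)) + offset (𝓘 (X ∩ Y))

    x⇒i : X ∈ᶠ 𝓘 → X ∩ Y ∈ᶠ 𝓘
    x⇒i = MI1 (p∩q⊆p X Y)

    combined : m < k ⊎ m ≡ k → m + d ≤ k + (offset (𝓘 X) + offset (𝓘 Y))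
    combined (inj₁ m<k) = begin
      m + d
        ≤⟨ +-monoʳ-≤ m (offset-submodular (𝓘 (X ∪ Y)) (𝓘 (X ∩ Y)) (𝓘 X) (𝓘 Y) x⇒i) ⟩
      m + suc (offset (𝓘 X) + offset (𝓘 Y))    ≡⟨ +-suc m _ ⟩
      suc m + (offset (𝓘 X) + offset (𝓘 Y))    ≤⟨ +-monoˡ-≤ _ m<k ⟩
      k + (offset (𝓘 X) + offset (𝓘 Y))        ∎
    combined (inj₂ m≡k) = +-mono-≤ (≤-reflexive m≡k)
      (offset-modular (𝓘 (X ∪ Y)) (𝓘 (X ∩ Y)) (𝓘 X) (𝓘 Y) x⇒i (MI1 (p∩q⊆q X Y))
        (λ x y → MI3 x y (sym m≡k)))

  preimage : Matroid n
  preimage = record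
    { rank = rank⁺
    ; R1   = rank⁺≤size
    ; R2   = rank⁺-mono
    ; R3   = rank⁺-submodular
    }

  total : ∀ b → totalRank M + offset b ≡ totalRank M ⊎
                totalRank M + offset b ≡ suc (totalRank M)
  total true  = inj₁ (+-identityʳ _)
  total false = inj₂ (+-comm _ 1)

  isElementaryPreimage : IsElementaryPreimage M preimage
  isElementaryPreimage = quotient , total (𝓘 ⊤)
    where
    quotient : IsQuotientMap preimage M
    -- Both summands of `rank⁺` are monotone, so if the sum does not grow, neither does `rank`.
    quotient F flat e eq = flat e (≤-antisym
      (+-cancelʳ-≤ (offset (𝓘 F)) _ _ (begin
        rank (F ∪ ⁅ e ⁆) + offset (𝓘 F)
          ≤⟨ +-monoʳ-≤ _ (offset-anti (𝓘 F) (𝓘 (F ∪ ⁅ e ⁆)) (MI1 (p⊆p∪q _))) ⟩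
        rank⁺ (F ∪ ⁅ e ⁆)       ≡⟨ eq ⟩
        rank F + offset (𝓘 F)   ∎))
      (R2 (p⊆p∪q _)))

module PreimageToIdeal (M N : Matroid n) (pre : IsElementaryPreimage M N) where
  private
    module M = MatroidProperties M
    module N = MatroidProperties N
  open PreimageProperties M N pre
  open ≤-Reasoning

  equalRank : Family n
  equalRank X = N.rank X ≡ᵇ M.rank X

  ∈⇒≡ : X ∈ᶠ equalRank → N.rank X ≡ M.rank X
  ∈⇒≡ = ≡ᵇ⇒≡ _ _

  ≤⇒∈ : N.rank X ≤ M.rank X → X ∈ᶠ equalRank
  ≤⇒∈ le = ≡⇒≡ᵇ _ _ (≤-antisym le (rank≤preimage _))

  -- The difference r_N - r_M is nonnegative and monotone, so its vanishing passes to subsets.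
  equalRank-complex : IsSimplicialComplex equalRank
  equalRank-complex {X} {Y} X⊆Y Y∈ = ≤⇒∈ (+-cancelʳ-≤ (M.rank Y) _ _ (begin
    N.rank X + M.rank Y    ≤⟨ rank-quotient X⊆Y ⟩
    N.rank Y + M.rank X    ≡⟨ cong (_+ M.rank X) (∈⇒≡ {Y} Y∈) ⟩
    M.rank Y + M.rank X    ≡⟨ +-comm (M.rank Y) _ ⟩
    M.rank X + M.rank Y    ∎))

  -- Submodularity of `N` bounds r_N on union plus intersection by the same sum for r_M; as r_M is
  -- at most r_N on the intersection, r_N is at most r_M on the union.
  equalRank-modular : X ∈ᶠ equalRank → Y ∈ᶠ equalRank → IsModularPair M X Y →
                      X ∪ Y ∈ᶠ equalRank
  equalRank-modular {X} {Y} X∈ Y∈ modular =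
    ≤⇒∈ (+-cancelʳ-≤ (M.rank (X ∩ Y)) _ _ (begin
      N.rank (X ∪ Y) + M.rank (X ∩ Y)    ≤⟨ +-monoʳ-≤ _ (rank≤preimage _) ⟩
      N.rank (X ∪ Y) + N.rank (X ∩ Y)    ≤⟨ N.R3 X Y ⟩
      N.rank X + N.rank Y                ≡⟨ cong₂ _+_ (∈⇒≡ {X} X∈) (∈⇒≡ {Y} Y∈) ⟩
      M.rank X + M.rank Y                ≡⟨ modular ⟩
      M.rank (X ∪ Y) + M.rank (X ∩ Y)    ∎))

  isModularIdeal : IsModularIdeal M equalRank
  isModularIdeal = record
    { nonEmpty = ⊥ , ≤⇒∈ (subst (_≤ M.rank ⊥) (sym N.rank-⊥) z≤n)
    ; MI1 = equalRank-complex
    ; MI2 = λ e ¬loop → ≤⇒∈ (≤-trans (N.rank-⁅⁆ e) (n≢0⇒n>0 ¬loop))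
    ; MI3 = equalRank-modular
    }

-- Extensions by a point

module PreimageToCoextension (M N : Matroid n) (pre : IsElementaryPreimage M N) where
  private
    module M = MatroidProperties M
    module N = MatroidProperties N
  open PreimageProperties M N pre
  open ≤-Reasoning

  -- Deleting the point leaves `N` and contracting it leaves `M`; the `suc` is the rank of the
  -- point.
  rankᵖ : Subset (suc n) → ℕ
  rankᵖ (outside ∷ X) = N.rank X
  rankᵖ (inside  ∷ X) = suc (M.rank X)

  rankᵖ≤size : ∀ X → rankᵖ X ≤ ∣ X ∣
  rankᵖ≤size (outside ∷ X) = N.R1 X
  rankᵖ≤size (inside  ∷ X) = s≤s (M.R1 X)

  rankᵖ-mono : ∀ X Y → X ⊆ Y → rankᵖ X ≤ rankᵖ Y
  rankᵖ-mono (outside ∷ X) (outside ∷ Y) X⊆Y = N.R2 (drop-∷-⊆ X⊆Y)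
  rankᵖ-mono (inside  ∷ X) (inside  ∷ Y) X⊆Y = s≤s (M.R2 (drop-∷-⊆ X⊆Y))
  -- Here the preimage has to be elementary: r_N may exceed r_M by at most 1.
  rankᵖ-mono (outside ∷ X) (inside  ∷ Y) X⊆Y =
    ≤-trans (N.R2 (drop-∷-⊆ X⊆Y)) (preimage≤suc Y)
  rankᵖ-mono (inside  ∷ X) (outside ∷ Y) X⊆Y with () ← X⊆Y here

  -- Submodularity when exactly one set contains the point: `R3` for `M` plus monotonicity of r_N -
  -- r_M from `X ∩ Y` to `Y`.
  mixed : ∀ X Y → M.rank (X ∪ Y) + N.rank (X ∩ Y) ≤ M.rank X + N.rank Y
  mixed X Y = +-cancelʳ-≤ (M.rank (X ∩ Y) + M.rank Y) _ _ (begin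
    M.rank (X ∪ Y) + N.rank (X ∩ Y) + (M.rank (X ∩ Y) + M.rank Y)
      ≡⟨ interchange +-commutativeSemigroup (M.rank (X ∪ Y)) _ _ _ ⟩
    M.rank (X ∪ Y) + M.rank (X ∩ Y) + (N.rank (X ∩ Y) + M.rank Y)
      ≤⟨ +-mono-≤ (M.R3 X Y) (rank-quotient (p∩q⊆q X Y)) ⟩
    M.rank X + M.rank Y + (N.rank Y + M.rank (X ∩ Y))
      ≡⟨ interchange +-commutativeSemigroup (M.rank X) _ _ _ ⟩
    M.rank X + N.rank Y + (M.rank Y + M.rank (X ∩ Y))
      ≡⟨ cong (M.rank X + N.rank Y +_) (+-comm (M.rank Y) _) ⟩
    M.rank X + N.rank Y + (M.rank (X ∩ Y) + M.rank Y)    ∎)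

  rankᵖ-submodular : ∀ X Y → rankᵖ (X ∪ Y) + rankᵖ (X ∩ Y) ≤ rankᵖ X + rankᵖ Y
  rankᵖ-submodular (outside ∷ X) (outside ∷ Y) = N.R3 X Y
  rankᵖ-submodular (inside  ∷ X) (outside ∷ Y) = s≤s (mixed X Y)
  rankᵖ-submodular (outside ∷ X) (inside  ∷ Y) = begin
    suc (M.rank (X ∪ Y) + N.rank (X ∩ Y))
      ≡⟨ cong₂ (λ U L → suc (M.rank U + N.rank L)) (∪-comm X Y) (∩-comm X Y) ⟩
    suc (M.rank (Y ∪ X) + N.rank (Y ∩ X))    ≤⟨ s≤s (mixed Y X) ⟩
    suc (M.rank Y + N.rank X)                ≡⟨ +-comm (suc (M.rank Y)) _ ⟩
    N.rank X + suc (M.rank Y)                ∎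
  rankᵖ-submodular (inside  ∷ X) (inside  ∷ Y) = s≤s (begin
    M.rank (X ∪ Y) + suc (M.rank (X ∩ Y))    ≡⟨ +-suc _ _ ⟩
    suc (M.rank (X ∪ Y) + M.rank (X ∩ Y))    ≤⟨ s≤s (M.R3 X Y) ⟩
    suc (M.rank X + M.rank Y)                ≡⟨ +-suc _ _ ⟨
    M.rank X + suc (M.rank Y)                ∎)

  coextension : Matroid (suc n)
  coextension = record
    { rank = rankᵖ
    ; R1   = rankᵖ≤size
    ; R2   = λ {X} {Y} → rankᵖ-mono X Y
    ; R3   = rankᵖ-submodular
    }

  isRankIncreasingCoextension : IsRankIncreasingCoextension M coextension
  isRankIncreasingCoextension =
    (λ X → sym (cong (M.rank X ∸_) M.rank-⊥)) , ≤-refl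

deletePt : Matroid (suc n) → Matroid n
deletePt M = record
  { rank = λ X → rank (outside ∷ X)
  ; R1   = λ X → R1 (outside ∷ X)
  ; R2   = λ X⊆Y → R2 (s⊆s X⊆Y)
  ; R3   = λ X Y → R3 (outside ∷ X) (outside ∷ Y)
  }
  where open Matroid M

module CoextensionProperties (M : Matroid n) (Ñ : Matroid (suc n))
                             (coext : IsRankIncreasingCoextension M Ñ) where
  private
    module M = MatroidProperties M
    module Ñ = MatroidProperties Ñ
  open ≤-Reasoning

  -- Contracting a loop would leave the total rank unchanged.
  pt-nonloop : ¬ IsLoop Ñ pt
  pt-nonloop loop = <⇒≢ (proj₂ coext)
    (trans (proj₁ coext ⊤) (cong (Ñ.rank (⊤ ∪pt) ∸_) loop))

  rank-pt : Ñ.rank ⁅ pt ⁆ ≡ 1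
  rank-pt = ≤-antisym (Ñ.rank-⁅⁆ pt) (n≢0⇒n>0 pt-nonloop)

  rank-∪pt : ∀ X → Ñ.rank (X ∪pt) ≡ suc (M.rank X)
  rank-∪pt X = trans
    (sym (m+[n∸m]≡n (subst (_≤ Ñ.rank (X ∪pt)) rank-pt (Ñ.R2 (s⊆s ⊥⊆)))))
    (cong suc (sym (trans (proj₁ coext X) (cong (Ñ.rank (X ∪pt) ∸_) rank-pt))))

  -- An element spanned by `F` in the deletion is spanned by `F ∪pt` in `Ñ`, hence by `F` in the
  -- contraction `M`. Since `Ñ` has total rank r(M) + 1, deleting one point leaves r(M) or r(M) + 1.
  delete-isElementaryPreimage : IsElementaryPreimage M (deletePt Ñ)
  delete-isElementaryPreimage = quotient , total
    where
    quotient : IsQuotientMap (deletePt Ñ) M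
    quotient F flat e eq = flat e (≤-antisym (s≤s⁻¹ (begin
      suc (M.rank (F ∪ ⁅ e ⁆))    ≡⟨ rank-∪pt _ ⟨
      Ñ.rank ((F ∪pt) ∪ ⁅ suc e ⁆)
        ≤⟨ Ñ.spans-mono (suc e) (out⊆ ⊆-refl) (≤-reflexive eq) ⟩
      Ñ.rank (F ∪pt)              ≡⟨ rank-∪pt F ⟩
      suc (M.rank F)              ∎)) (M.R2 (p⊆p∪q _)))

    lower : totalRank M ≤ Ñ.rank (outside ∷ ⊤)
    lower = s≤s⁻¹ (begin
      suc (M.rank ⊤)                         ≡⟨ rank-∪pt ⊤ ⟨
      Ñ.rank (⊤ ∪pt)                         ≡⟨ cong (Ñ.rank ∘ (inside ∷_)) (∪-identityʳ ⊤) ⟨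
      Ñ.rank ((outside ∷ ⊤) ∪ ⁅ pt ⁆)        ≤⟨ Ñ.rank-∪ (outside ∷ ⊤) ⁅ pt ⁆ ⟩
      Ñ.rank (outside ∷ ⊤) + Ñ.rank ⁅ pt ⁆   ≡⟨ cong (Ñ.rank (outside ∷ ⊤) +_) rank-pt ⟩
      Ñ.rank (outside ∷ ⊤) + 1               ≡⟨ +-comm _ 1 ⟩
      suc (Ñ.rank (outside ∷ ⊤))             ∎)

    upper : Ñ.rank (outside ∷ ⊤) ≤ suc (totalRank M)
    upper = subst (Ñ.rank (outside ∷ ⊤) ≤_) (rank-∪pt ⊤) (Ñ.R2 (out⊆ ⊆-refl))

    total : Ñ.rank (outside ∷ ⊤) ≡ totalRank M ⊎
            Ñ.rank (outside ∷ ⊤) ≡ suc (totalRank M)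
    total with m≤n⇒m<n∨m≡n upper
    ... | inj₁ lt = inj₁ (≤-antisym (s≤s⁻¹ lt) lower)
    ... | inj₂ eq = inj₂ eq

contract-isRankIncreasingCoextension : (M : Matroid (suc n)) → ¬ IsLoop M pt →
  IsRankIncreasingCoextension (contractPt M) M
contract-isRankIncreasingCoextension M ¬loop =
  (λ _ → refl) ,
  ∸-monoʳ-< (n≢0⇒n>0 ¬loop) (R2 (s⊆s ⊥⊆))
  where open Matroid M

-- The correspondences

module _ {A B : Setoid 0ℓ 0ℓ} where
  private
    module A = Setoid A
    module B = Setoid B

  -- Congruence upgrades the pointwise inverse laws to the laws up to equivalence that `Inverse`
  -- demands.
  strictInverse : (f : A.Carrier → B.Carrier) (g : B.Carrier → A.Carrier) →
                  Congruent A._≈_ B._≈_ f → Congruent B._≈_ A._≈_ g →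
                  StrictlyInverseˡ B._≈_ f g → StrictlyInverseʳ A._≈_ f g →
                  Inverse A B
  strictInverse f g f-cong g-cong fg gf = record
    { to        = f
    ; from      = g
    ; to-cong   = f-cong
    ; from-cong = g-cong
    ; inverse   = Consequences.strictlyInverseˡ⇒inverseˡ A B f-cong fg
                , Consequences.strictlyInverseʳ⇒inverseʳ A B g-cong gf
    }

module _ (A B : Semimatroid n) where
  private
    module A = SemimatroidProperties A
    module B = SemimatroidProperties B

  rankOrZero-cong : Setoid._≈_ (Semimat n) A B → ∀ X → A.rankOrZero X ≡ B.rankOrZero X
  rankOrZero-cong (𝓒≗ , rank≗) X with T? (A.𝓒 X)
  ... | yes a = trans (rank≗ X a b) (sym (B.rankOrZero-member X b))
    where b = subst T (𝓒≗ X) a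
  ... | no ¬a = sym (B.rankOrZero-nonmember X (¬a ∘ subst T (sym (𝓒≗ X))))

semimatroid↔ideal : ∀ n → Inverse (Semimat n) (MatId n)
semimatroid↔ideal n = strictInverse
  (λ C → let open SemimatroidProperties C in (hull , 𝓒) , isModularIdeal)
  (λ ((M , _) , ideal) → restrict M ideal)
  (λ {A} {B} A≈B → maxRank-cong (rankOrZero-cong A B A≈B) , proj₁ A≈B)
  (λ (M≈ , 𝓘≗) → 𝓘≗ , (λ X _ _ → M≈ X))
  (λ ((M , 𝓘) , ideal) → hull-restrict M ideal , (λ _ → refl))
  (λ C → let open SemimatroidProperties C in
    -- The membership proof `a` is irrelevant; decidability of membership turns it into a usable
    -- one.
    (λ _ → refl) , (λ X a _ → hullRank-member X (recompute (T? (𝓒 X)) a)))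
  where
  -- Members inside `X` have at most its rank, and a spanning member reaches it.
  hull-restrict : ∀ M {𝓘} (ideal : IsModularIdeal M 𝓘) →
                  SemimatroidProperties.hull (restrict M ideal) ≈ᴹ M
  hull-restrict M ideal X = ≤-antisym upper lower
    where
    open IdealProperties M ideal
    module C = SemimatroidProperties (restrict M ideal)

    upper : C.hullRank X ≤ rank X
    upper with C.hullRank-attained X
    ... | Y , _ , Y⊆X , eq = subst (_≤ rank X) eq (R2 Y⊆X)

    lower : rank X ≤ C.hullRank X
    lower with spanning-member X
    ... | Y , y , Y⊆X , rX≤rY = ≤-trans rX≤rY (C.hullRank-upper y Y⊆X)

ideal↔preimage : ∀ n → Inverse (MatId n) (MatPreim n)
ideal↔preimage n = strictInverse
  (λ ((M , _) , ideal) →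
    let open IdealToPreimage M ideal in (M , preimage) , isElementaryPreimage)
  (λ ((M , N) , pre) →
    let open PreimageToIdeal M N pre in (M , equalRank) , isModularIdeal)
  (λ (M≈ , 𝓘≗) → M≈ , (λ X → cong₂ _+_ (M≈ X) (cong offset (𝓘≗ X))))
  (λ (M≈ , N≈) → M≈ , (λ X → cong₂ _≡ᵇ_ (N≈ X) (M≈ X)))
  (λ ((M , N) , pre) → let open PreimageProperties M N pre in
    (λ _ → refl) , (λ X → offset-≡ᵇ (rank≤preimage X) (preimage≤suc X)))
  (λ ((M , 𝓘) , _) → (λ _ → refl) , (λ X → ≡ᵇ-offset (Matroid.rank M X) (𝓘 X)))

preimage↔coextension : ∀ n → Inverse (MatPreim n) (MatCoext n)
preimage↔coextension n = strictInverse
  (λ ((M , N) , pre) →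
    let open PreimageToCoextension M N pre
    in (M , coextension) , isRankIncreasingCoextension)
  (λ ((M , Ñ) , coext) →
    (M , deletePt Ñ) , CoextensionProperties.delete-isElementaryPreimage M Ñ coext)
  (λ (M≈ , N≈) → M≈ ,
    (λ { (outside ∷ X) → N≈ X ; (inside ∷ X) → cong suc (M≈ X) }))
  (λ (M≈ , Ñ≈) → M≈ , (λ X → Ñ≈ (outside ∷ X)))
  (λ ((M , Ñ) , coext) → (λ _ → refl) ,
    (λ { (outside ∷ X) → refl
       ; (inside  ∷ X) → sym (CoextensionProperties.rank-∪pt M Ñ coext X) }))
  (λ _ → (λ _ → refl) , (λ _ → refl))

coextension↔pointed : ∀ n → Inverse (MatCoext n) (Pointedmat n)
coextension↔pointed n = strictInverse
  (λ ((M , Ñ) , coext) →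
    (Ñ , pt) , refl , CoextensionProperties.pt-nonloop M Ñ coext)
  (λ { ((M , q) , refl , ¬loop) →
    (contractPt M , M) , contract-isRankIncreasingCoextension M ¬loop })
  (λ (_ , Ñ≈) → Ñ≈ , refl)
  (λ { {(_ , _) , refl , _} {(_ , _) , refl , _} (M≈ , _) →
    (λ X → cong₂ _∸_ (M≈ (X ∪pt)) (M≈ ⁅ pt ⁆)) , M≈ })
  (λ { ((M , q) , refl , _) → (λ _ → refl) , refl })
  -- The first component comes back as the contraction of `Ñ`, which equals `M` because `Ñ` is a
  -- coextension of it.
  (λ ((M , Ñ) , coext) → (λ X → sym (proj₁ coext X)) , (λ _ → refl))

theorem5p3 : ∀ (n : ℕ) →
    Inverse (Semimat n) (MatId n)
    × Inverse (MatId n) (MatPreim n)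
    × Inverse (MatPreim n) (MatCoext n)
    × Inverse (MatCoext n) (Pointedmat n)
theorem5p3 n =
  semimatroid↔ideal n , ideal↔preimage n ,
  preimage↔coextension n , coextension↔pointed n
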